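{- Let $f : A \to B$ be a map of types. The following are equivalent: (i) $f$ is an epimorphism; (ii) $f$ is a dependent epimorphism; (iii) $f$ is acyclic; (iv) the codiagonal $\nabla_f : B +_A B \to B$ is an equivalence.
   Context: We work in homotopy type theory (HoTT) in the style of the HoTT Book: dependent type theory with univalent universes (hence function extensionality) and higher inductive types such as pushouts; no classical axioms are assumed. A map is an embedding if its action on identity types is an equivalence. A map $f : A \to B$ is an epimorphism if for every type $X$ (in the universes under consideration) the precomposition map $f^* : (B \to X) \to (A \to X)$ is an embedding. It is a dependent epimorphism if for every type family $P$ over $B$ the precomposition map $f^* : \prod_{b:B} P(b) \to \prod_{a:A} P(f(a))$ is an embedding. The suspension $\Sigma A$ of a type $A$ is the pushout of $\mathbf{1} \leftarrow A \to \mathbf{1}$. A type is acyclic if its suspension is contractible; a map is acyclic if all its fibers are acyclic types. The codiagonal $\nabla_f$ of $f : A \to B$ is the map $B +_A B \to B$ out of the pushout of $B \xleftarrow{f} A \xrightarrow{f} B$ induced by $\mathrm{id}_B$ on both copies of $B$ (and reflexivity on $A$). -}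

{-# OPTIONS --without-K #-}
module Defs where

open import Axiom.Extensionality.Propositional using (Extensionality)
open import Data.Product.Base using (Σ-syntax)
open import Data.Unit.Base using (⊤; tt)
open import Function.Base using (id)
open import Level using (Level; _⊔_; Setω)
open import Relation.Binary.PropositionalEquality using (_≡_; refl; cong; dcong; subst; trans)

private
  variable
    a b c ℓ : Level
    A : Set a
    B : Set b
    C : Set c

IsContr : Set a → Set a
IsContr A = Σ[ x ∈ A ] (∀ y → x ≡ y)

fiber : (A → B) → B → Set _
fiber {A = A} f y = Σ[ x ∈ A ] f x ≡ y

IsEquiv : (A → B) → Set _
IsEquiv f = ∀ y → IsContr (fiber f y)

IsEmbedding : (A → B) → Set _
IsEmbedding f = ∀ x y → IsEquiv (cong f {x} {y})

-- Univalence itself is not assumed, only this consequence of it.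
FunExt : Setω
FunExt = ∀ {a b} → Extensionality a b

-- The pushout of B ←f– A –g→ C as a higher inductive type.  Agda without
-- cubical features has no such types, so its formation, introduction,
-- elimination (into every universe) and computation rules are the fields of a
-- record.  All computation rules are identifications; the one for glue is
-- therefore stated modulo those for inl and inr.
record Pushout {A : Set a} {B : Set b} {C : Set c}
               (f : A → B) (g : A → C) : Setω where
  field
    Carrier : Set (a ⊔ b ⊔ c)
    inl     : B → Carrier
    inr     : C → Carrier
    glue    : ∀ x → inl (f x) ≡ inr (g x)

    elim : (P : Carrier → Set ℓ)
           (l : ∀ y → P (inl y)) (r : ∀ z → P (inr z)) →
           (∀ x → subst P (glue x) (l (f x)) ≡ r (g x)) →
           ∀ w → P w

    elim-inl : (P : Carrier → Set ℓ)
               (l : ∀ y → P (inl y)) (r : ∀ z → P (inr z))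
               (p : ∀ x → subst P (glue x) (l (f x)) ≡ r (g x)) →
               ∀ y → elim P l r p (inl y) ≡ l y

    elim-inr : (P : Carrier → Set ℓ)
               (l : ∀ y → P (inl y)) (r : ∀ z → P (inr z))
               (p : ∀ x → subst P (glue x) (l (f x)) ≡ r (g x)) →
               ∀ z → elim P l r p (inr z) ≡ r z

    elim-glue : (P : Carrier → Set ℓ)
                (l : ∀ y → P (inl y)) (r : ∀ z → P (inr z))
                (p : ∀ x → subst P (glue x) (l (f x)) ≡ r (g x)) →
                ∀ x → trans (dcong (elim P l r p) (glue x))
                            (elim-inr P l r p (g x))
                    ≡ trans (cong (subst P (glue x)) (elim-inl P l r p (f x)))
                            (p x)

  rec : {X : Set ℓ} (l : B → X) (r : C → X) →
        (∀ x → l (f x) ≡ r (g x)) → Carrier → X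
  rec {X = X} l r p =
    elim (λ _ → X) l r (λ x → trans (subst-const (glue x)) (p x))
    where
    subst-const : ∀ {v w} (q : v ≡ w) {t : X} → subst (λ _ → X) q t ≡ t
    subst-const refl = refl

HasPushouts : Setω
HasPushouts = ∀ {a b c} {A : Set a} {B : Set b} {C : Set c}
              (f : A → B) (g : A → C) → Pushout f g

IsEpimorphism : {A : Set a} {B : Set b} → (A → B) → Setω
IsEpimorphism {B = B} f =
  ∀ {ℓ} (X : Set ℓ) → IsEmbedding (λ (h : B → X) x → h (f x))

IsDependentEpimorphism : {A : Set a} {B : Set b} → (A → B) → Setω
IsDependentEpimorphism {B = B} f =
  ∀ {ℓ} (P : B → Set ℓ) → IsEmbedding (λ (h : ∀ y → P y) x → h (f x))

module _ (pushout : HasPushouts) where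

  Suspension : Set a → Set a
  Suspension A = Pushout.Carrier (pushout (λ (_ : A) → tt) (λ (_ : A) → tt))

  IsAcyclic : Set a → Set a
  IsAcyclic A = IsContr (Suspension A)

  IsAcyclicMap : {A : Set a} {B : Set b} → (A → B) → Set (a ⊔ b)
  IsAcyclicMap f = ∀ y → IsAcyclic (fiber f y)

  codiagonal : {A : Set a} {B : Set b} (f : A → B) →
               Pushout.Carrier (pushout f f) → B
  codiagonal f = Pushout.rec (pushout f f) id id (λ _ → refl)

-- Mutual equivalence of four conditions, as a cycle of implications.  The first
-- two live in Setω because they quantify over types of every universe.
record AllEquivalent {p q} (P₁ P₂ : Setω) (P₃ : Set p) (P₄ : Set q) : Setω where
  field
    1⇒2 : P₁ → P₂
    2⇒3 : P₂ → P₃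
    3⇒4 : P₃ → P₄
    4⇒1 : P₄ → P₁

{-# OPTIONS --safe #-}
{-# OPTIONS --without-K #-}
module Submission where

-- Each condition says that homotopies extend along f: a homotopy
-- h ∘ f ~ k ∘ f is the restriction of a homotopy h ~ k, either for all
-- families, or for all constant families, or only for inl, inr and glue into
-- B +_A B.  A mere section of the restriction of homotopies suffices for
-- f^* to be an embedding, because identity types are initial among the
-- reflexive relations.  The fiberwise form is that the north and south poles
-- of the suspension of each fiber are joined by a path that agrees with all
-- meridians, which is acyclicity; no flattening lemma or univalence is needed.

open import Defs
open import Data.Product.Base using (Σ; Σ-syntax; _,_; proj₁; proj₂)
open import Data.Unit.Base using (tt)
open import Function.Base using (id)
open import Function.Bundles using (mk↔ₛ′)
open import Function.Properties.Inverse.HalfAdjointEquivalence using (_≃_; ↔⇒≃)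
open import Level using (Level; _⊔_)
open import Relation.Binary.PropositionalEquality
  using (_≡_; refl; sym; trans; cong; cong-app; dcong; subst; module ≡-Reasoning)
open import Relation.Binary.PropositionalEquality.Properties
  using (trans-assoc; trans-reflʳ; trans-symˡ; cong-id)

private
  variable
    a b c p ℓ : Level
    A : Set a
    B : Set b

-- Fibers, equivalences and embeddings.

contr-path : (c : IsContr A) {x y : A} (q : x ≡ y) →
             q ≡ trans (sym (proj₂ c x)) (proj₂ c y)
contr-path c {x} refl = sym (trans-symˡ (proj₂ c x))

contr-paths-equal : IsContr A → {x y : A} (q r : x ≡ y) → q ≡ r
contr-paths-equal c q r = trans (contr-path c q) (sym (contr-path c r))

fiber-path : (f : A → B) {x x′ : A} {y : B} {q : f x ≡ y} {q′ : f x′ ≡ y}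
             (r : x ≡ x′) → trans (cong f r) q′ ≡ q →
             Σ[ s ∈ _≡_ {A = fiber f y} (x , q) (x′ , q′) ] cong proj₁ s ≡ r
fiber-path f refl refl = refl , refl

invertible⇒IsEquiv : (f : A → B) (g : B → A) → (∀ y → f (g y) ≡ y) →
                     (∀ x → g (f x) ≡ x) → IsEquiv f
invertible⇒IsEquiv f g fg gf y = (from y , right-inverse-of y) , contract
  where
  -- The half-adjoint adjustment supplies the triangle identity that a path in the fiber needs.
  open _≃_ (↔⇒≃ (mk↔ₛ′ f g fg gf))

  contract : ∀ z → (from y , right-inverse-of y) ≡ z
  contract (x , refl) = proj₁ (fiber-path f (left-inverse-of x)
    (trans (trans-reflʳ _) (left-right x)))

-- The section s need not send refl to refl, hence the correction by s refl.
sections⇒IsEmbedding : (f : A → B) (s : ∀ {x y} → f x ≡ f y → x ≡ y) →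
                       (∀ {x y} (q : f x ≡ f y) → cong f (s q) ≡ q) →
                       IsEmbedding f
sections⇒IsEmbedding f s cs x y = invertible⇒IsEquiv (cong f) s′ right left
  where
  s′ : ∀ {z} → f x ≡ f z → x ≡ z
  s′ q = trans (sym (s refl)) (s q)

  left : ∀ {z} (q : x ≡ z) → s′ (cong f q) ≡ q
  left refl = trans-symˡ (s refl)

  cong-s′ : ∀ {v z} (q : x ≡ v) (r : x ≡ z) →
            cong f (trans (sym q) r) ≡ trans (sym (cong f q)) (cong f r)
  cong-s′ refl r = refl

  right : ∀ {z} (q : f x ≡ f z) → cong f (s′ q) ≡ q
  right q = begin
    cong f (trans (sym (s refl)) (s q))          ≡⟨ cong-s′ (s refl) (s q) ⟩
    trans (sym (cong f (s refl))) (cong f (s q)) ≡⟨ cong (λ r → trans (sym r) (cong f (s q))) (cs refl) ⟩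
    cong f (s q)                                 ≡⟨ cs q ⟩
    q                                            ∎
    where open ≡-Reasoning

-- Function extensionality.

module StrongFunExt (ext : FunExt) where

  funext : {P : A → Set p} {h k : ∀ x → P x} → (∀ x → h x ≡ k x) → h ≡ k
  funext H = trans (sym (ext (λ _ → refl))) (ext H)

  funext-cong-app : {P : A → Set p} {h k : ∀ x → P x} (q : h ≡ k) →
                    funext (cong-app q) ≡ q
  funext-cong-app refl = trans-symˡ (ext (λ _ → refl))

  -- A homotopy out of h is a family of points of the singletons Σ z , h x ≡ z,
  -- so it may be assumed to be λ x → refl.
  cong-app-funext : {P : A → Set p} {h k : ∀ x → P x} (H : ∀ x → h x ≡ k x) →
                    ∀ x → cong-app (funext H) x ≡ H x
  cong-app-funext {A = A} {P = P} {h = h} {k} H =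
    subst (λ m → ∀ x → cong-app (funext (λ x → proj₂ (m x))) x ≡ proj₂ (m x))
          (ext (λ x → singleton (H x)))
          (λ x → cong (λ q → cong-app q x) (funext-cong-app refl))
    where
    singleton : ∀ {x z} (q : h x ≡ z) →
                _≡_ {A = Σ[ z ∈ P x ] h x ≡ z} (h x , refl) (z , q)
    singleton refl = refl

-- Extension of homotopies.

-- Pointwise form of a section of restriction, so that function extensionality enters only in
-- passing to and from embeddings.
HomotopyExtension : (f : A → B) (P : B → Set ℓ) (h k : ∀ y → P y) → Set _
HomotopyExtension f P h k =
  (H : ∀ x → h (f x) ≡ k (f x)) →
  Σ[ K ∈ (∀ y → h y ≡ k y) ] (∀ x → K (f x) ≡ H x)

module _ (ext : FunExt) (f : A → B) (P : B → Set ℓ) where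

  open StrongFunExt ext

  private
    restrict : (∀ y → P y) → ∀ x → P (f x)
    restrict h x = h (f x)

    cong-app-restrict : ∀ {h k} (q : h ≡ k) x →
                        cong-app (cong restrict q) x ≡ cong-app q (f x)
    cong-app-restrict refl x = refl

  IsEmbedding⇒HomotopyExtension :
    IsEmbedding restrict → ∀ h k → HomotopyExtension f P h k
  IsEmbedding⇒HomotopyExtension emb h k H = cong-app q , λ x → begin
    cong-app q (f x)             ≡⟨ cong-app-restrict q x ⟨
    cong-app (cong restrict q) x ≡⟨ cong (λ r → cong-app r x) eq ⟩
    cong-app (funext H) x        ≡⟨ cong-app-funext H x ⟩
    H x                          ∎
    where
    open ≡-Reasoning
    q  = proj₁ (proj₁ (emb h k (funext H)))
    eq = proj₂ (proj₁ (emb h k (funext H)))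

  HomotopyExtension⇒IsEmbedding :
    (∀ h k → HomotopyExtension f P h k) → IsEmbedding restrict
  HomotopyExtension⇒IsEmbedding extend =
    sections⇒IsEmbedding restrict
      (λ {h} {k} q → funext (proj₁ (extend h k (cong-app q))))
      λ {h} {k} q → let K , K∘f = extend h k (cong-app q) in begin
        cong restrict (funext K)                     ≡⟨ funext-cong-app _ ⟨
        funext (cong-app (cong restrict (funext K))) ≡⟨ cong funext (ext (λ x →
                                                          trans (cong-app-restrict (funext K) x)
                                                         (trans (cong-app-funext K (f x)) (K∘f x)))) ⟩
        funext (cong-app q)                          ≡⟨ funext-cong-app q ⟩
        q                                            ∎
    where open ≡-Reasoning

-- Recursion from pushouts.

module PushoutProperties {A : Set a} {B : Set b} {C : Set c}
                         {f : A → B} {g : A → C} (W : Pushout f g) where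

  open Pushout W

  module _ {X : Set ℓ} (l : B → X) (r : C → X) (p : ∀ x → l (f x) ≡ r (g x)) where

    rec-inl : ∀ y → rec l r p (inl y) ≡ l y
    rec-inl = elim-inl (λ _ → X) l r _

    rec-inr : ∀ z → rec l r p (inr z) ≡ r z
    rec-inr = elim-inr (λ _ → X) l r _

    private
      -- The underscore stands for a term with the function subst-const, which
      -- is local to the definition of rec and cannot be named here.
      dcong-rec-glue : ∀ x →
        trans (dcong (rec l r p) (glue x)) (rec-inr (g x)) ≡
        trans (cong (subst (λ _ → X) (glue x)) (rec-inl (f x))) _
      dcong-rec-glue = elim-glue (λ _ → X) l r _

    rec-glue : ∀ x → trans (cong (rec l r p) (glue x)) (rec-inr (g x)) ≡
                     trans (rec-inl (f x)) (p x)
    -- With its endpoint abstracted, `glue x` can be taken to be `refl`, where transport is trivial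
    -- and `dcong` agrees with `cong`.
    rec-glue x
      with inr (g x) | glue x | rec-inr (g x) | dcong-rec-glue x
    ... | _ | refl | _ | e = trans e (cong (λ q → trans q (p x)) (cong-id _))

    rec-path : ∀ {y z} → inl y ≡ inr z → l y ≡ r z
    rec-path {y} {z} q =
      trans (sym (rec-inl y)) (trans (cong (rec l r p) q) (rec-inr z))

    rec-path-glue : ∀ x → rec-path (glue x) ≡ p x
    rec-path-glue x = begin
      trans (sym (rec-inl (f x))) (trans (cong (rec l r p) (glue x)) (rec-inr (g x)))
        ≡⟨ cong (trans (sym (rec-inl (f x)))) (rec-glue x) ⟩
      trans (sym (rec-inl (f x))) (trans (rec-inl (f x)) (p x))
        ≡⟨ trans-assoc (sym (rec-inl (f x))) ⟨
      trans (trans (sym (rec-inl (f x))) (rec-inl (f x))) (p x)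
        ≡⟨ cong (λ q → trans q (p x)) (trans-symˡ (rec-inl (f x))) ⟩
      p x ∎
      where open ≡-Reasoning

-- Suspensions.

module _ (pushout : HasPushouts) (A : Set a) where

  private
    S = pushout (λ (_ : A) → tt) (λ (_ : A) → tt)

  open Pushout S

  PolesJoined : Set a
  PolesJoined = Σ[ σ ∈ inl tt ≡ inr tt ] (∀ x → σ ≡ glue x)

  IsAcyclic⇒PolesJoined : IsAcyclic pushout A → PolesJoined
  IsAcyclic⇒PolesJoined c =
    trans (sym (proj₂ c _)) (proj₂ c _) , λ x → contr-paths-equal c _ (glue x)

  -- Contract onto the north pole, with `σ` at the south; along a meridian, `refl` is transported to
  -- that meridian, which equals `σ`.
  PolesJoined⇒IsAcyclic : PolesJoined → IsAcyclic pushout A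
  PolesJoined⇒IsAcyclic (σ , σ-glue) =
    inl tt ,
    elim (inl tt ≡_) (λ _ → refl) (λ _ → σ)
         (λ x → trans (subst-refl (glue x)) (sym (σ-glue x)))
    where
    subst-refl : ∀ {w} (q : inl tt ≡ w) → subst (inl tt ≡_) q refl ≡ q
    subst-refl refl = refl

-- Paths in total spaces and free loops.

module _ {P : B → Set p} where

  proj₂-path : {u v : Σ B P} (q : u ≡ v) →
               subst P (cong proj₁ q) (proj₂ u) ≡ proj₂ v
  proj₂-path refl = refl

  vertical-path : ∀ {y} {s t : P y} (q : (y , s) ≡ (y , t)) →
                  cong proj₁ q ≡ refl → s ≡ t
  vertical-path {s = s} q d =
    trans (cong (λ r → subst P r s) (sym d)) (proj₂-path q)

  cong-proj₁-cong-, : ∀ {y} {s t : P y} (q : s ≡ t) →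
                      cong proj₁ (cong (_,_ {B = P} y) q) ≡ refl
  cong-proj₁-cong-, refl = refl

  -- The proof of verticality is the one induced by `e`; another could change the resulting path.
  vertical-path-cong-, :
    ∀ {y} {s t : P y} (q : s ≡ t) {r} (e : r ≡ cong (y ,_) q) →
    vertical-path r (trans (cong (cong proj₁) e) (cong-proj₁-cong-, q)) ≡ q
  vertical-path-cong-, refl refl = refl

-- A path in the type of free loops conjugates the one loop into the other.
module _ {B : Set b} where

  trivial-loop : {u v : Σ[ y ∈ B ] y ≡ y} → u ≡ v →
                 proj₂ v ≡ refl → proj₂ u ≡ refl
  trivial-loop refl e = e

  trivial-loop-cong-, : ∀ {y : B} {q : y ≡ y} (e : q ≡ refl) →
                        trivial-loop (cong (y ,_) e) refl ≡ e
  trivial-loop-cong-, {y} e = trans (general e refl) (trans-reflʳ e)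
    where
    general : ∀ {q r : y ≡ y} (e : q ≡ r) (e′ : r ≡ refl) →
              trivial-loop (cong (y ,_) e) e′ ≡ trans e e′
    general refl e′ = refl

-- The homotopy extended into Σ B P need not lie over refl; but over B it is a
-- family of loops that is trivial on the image of f, so it can be trivialised
-- by extending once more, into the type of free loops of B.
constant⇒dependent :
  {A : Set a} {B : Set b} (f : A → B) →
  (∀ {ℓ} (X : Set ℓ) (g k : B → X) → HomotopyExtension f (λ _ → X) g k) →
  (P : B → Set p) → ∀ h k → HomotopyExtension f P h k
constant⇒dependent {B = B} f extend P h k H =
  (λ y → vertical-path (M y) (L-trivial y)) ,
  (λ x → trans (cong (vertical-path (M (f x)))
                     (trans (cong (λ q → trivial-loop q refl) (N∘f x))
                            (trivial-loop-cong-, (L∘f x))))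
               (vertical-path-cong-, (H x) (M∘f x)))
  where
  M-extension = extend (Σ B P) (λ y → y , h y) (λ y → y , k y)
                       (λ x → cong (f x ,_) (H x))
  M   = proj₁ M-extension
  M∘f = proj₂ M-extension

  L : ∀ y → y ≡ y
  L y = cong proj₁ (M y)

  -- This is the trivialisation that `vertical-path-cong-,` expects, and `N` extends exactly it.
  L∘f : ∀ x → L (f x) ≡ refl
  L∘f x = trans (cong (cong proj₁) (M∘f x)) (cong-proj₁-cong-, (H x))

  N-extension = extend (Σ[ y ∈ B ] y ≡ y) (λ y → y , L y) (λ y → y , refl)
                       (λ x → cong (f x ,_) (L∘f x))
  N   = proj₁ N-extension
  N∘f = proj₂ N-extension

  L-trivial : ∀ y → L y ≡ refl
  L-trivial y = trivial-loop (N y) refl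

-- The codiagonal and acyclic maps.

module _ (pushout : HasPushouts) {A : Set a} {B : Set b} (f : A → B) where

  private
    module W where
      open Pushout (pushout f f) public
      open PushoutProperties (pushout f f) public

    ∇ = codiagonal pushout f

    ∇-inl = W.rec-inl {X = B} id id (λ _ → refl)
    ∇-inr = W.rec-inr {X = B} id id (λ _ → refl)

    ∇-glue : ∀ x → trans (cong ∇ (W.glue x)) (∇-inr (f x)) ≡ ∇-inl (f x)
    ∇-glue x = trans (W.rec-glue id id (λ _ → refl) x) (trans-reflʳ _)

  -- The universal extension problem: recursion carries `inl`, `inr` and `glue` to any two maps and
  -- any homotopy between their restrictions.
  GlueExtension : Set (a ⊔ b)
  GlueExtension =
    Σ[ σ ∈ (∀ y → W.inl y ≡ W.inr y) ] (∀ x → σ (f x) ≡ W.glue x)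

  GlueExtension⇒constant :
    GlueExtension →
    (X : Set ℓ) (g k : B → X) → HomotopyExtension f (λ _ → X) g k
  GlueExtension⇒constant (σ , σ∘f) X g k H =
    (λ y → W.rec-path g k H (σ y)) ,
    (λ x → trans (cong (W.rec-path g k H) (σ∘f x)) (W.rec-path-glue g k H x))

  -- The inverse is `inl`; on the second copy of `B` this needs `σ`, and along `glue` the coherence
  -- `σ∘f`.
  GlueExtension⇒codiagonal : GlueExtension → IsEquiv ∇
  GlueExtension⇒codiagonal (σ , σ∘f) =
    invertible⇒IsEquiv ∇ W.inl ∇-inl
      (W.elim (λ w → W.inl (∇ w) ≡ w)
              (λ y → cong W.inl (∇-inl y))
              (λ y → trans (cong W.inl (∇-inr y)) (σ y))
              (λ x → trans (subst-naturality (W.glue x) (∇-inr (f x)) (∇-glue x))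
                           (cong (trans (cong W.inl (∇-inr (f x)))) (sym (σ∘f x)))))
    where
    subst-naturality :
      ∀ {y w} (q : W.inl y ≡ w) (t : ∇ w ≡ y) {s : ∇ (W.inl y) ≡ y} →
      trans (cong ∇ q) t ≡ s →
      subst (λ w → W.inl (∇ w) ≡ w) q (cong W.inl s) ≡ trans (cong W.inl t) q
    subst-naturality refl t refl = sym (trans-reflʳ _)

  -- Both `inl y` and `inr y` lie in the contractible fiber of `∇` over `y`, and `glue x` lifts to a
  -- path in the fiber over `f x`.
  codiagonal⇒GlueExtension : IsEquiv ∇ → GlueExtension
  codiagonal⇒GlueExtension c =
    (λ y → cong proj₁ (σ y)) ,
    (λ x → let s , proj₁-s = fiber-path ∇ (W.glue x) (∇-glue x) in
           trans (cong (cong proj₁) (contr-paths-equal (c (f x)) (σ (f x)) s)) proj₁-s)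
    where
    σ : ∀ y → (W.inl y , ∇-inl y) ≡ (W.inr y , ∇-inr y)
    σ y = trans (sym (proj₂ (c y) _)) (proj₂ (c y) _)

  -- Transporting `H` along the fiber sends each meridian to a path from `h y` to `k y`; the path
  -- joining the poles gives the extension, and the meridian at `(x , refl)` gives `H x`.
  acyclic⇒dependent :
    IsAcyclicMap pushout f →
    (P : B → Set ℓ) → ∀ h k → HomotopyExtension f P h k
  acyclic⇒dependent acyclic P h k H =
    (λ y → path y (proj₁ (joined y))) ,
    (λ x → trans (cong (path (f x)) (proj₂ (joined (f x)) (x , refl)))
                 (S.rec-path-glue (f x) _ _ _ (x , refl)))
    where
    module S y = PushoutProperties
      (pushout (λ (_ : fiber f y) → tt) (λ (_ : fiber f y) → tt))

    joined : ∀ y → PolesJoined pushout (fiber f y)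
    joined y = IsAcyclic⇒PolesJoined pushout (fiber f y) (acyclic y)

    path = λ y → S.rec-path y (λ _ → h y) (λ _ → k y)
      (λ (x , e) → subst (λ y → h y ≡ k y) e (H x)) {tt} {tt}

  -- In the family of suspended fibers, the meridians at `(x , refl)` form a homotopy between the
  -- poles over the image of `f`; its extension joins the poles everywhere.
  dependent⇒acyclic :
    (∀ {ℓ} (P : B → Set ℓ) h k → HomotopyExtension f P h k) →
    IsAcyclicMap pushout f
  dependent⇒acyclic extend y =
    PolesJoined⇒IsAcyclic pushout (fiber f y)
      (proj₁ σ-extension y , λ { (x , refl) → proj₂ σ-extension x })
    where
    module S y = Pushout
      (pushout (λ (_ : fiber f y) → tt) (λ (_ : fiber f y) → tt))

    σ-extension = extend (λ y → Suspension pushout (fiber f y))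
      (λ y → S.inl y tt) (λ y → S.inr y tt) (λ x → S.glue (f x) (x , refl))

theorem2p9 : FunExt → (pushout : HasPushouts) →
    ∀ {a b} {A : Set a} {B : Set b} (f : A → B) →
    AllEquivalent
    (IsEpimorphism f)
    (IsDependentEpimorphism f)
    (IsAcyclicMap pushout f)
    (IsEquiv (codiagonal pushout f))
theorem2p9 ext pushout f = record
  { 1⇒2 = λ epi P → HomotopyExtension⇒IsEmbedding ext f P
      (constant⇒dependent f
        (λ X → IsEmbedding⇒HomotopyExtension ext f (λ _ → X) (epi X)) P)
  ; 2⇒3 = λ depi → dependent⇒acyclic pushout f
      (λ P → IsEmbedding⇒HomotopyExtension ext f P (depi P))
  ; 3⇒4 = λ acyclic → GlueExtension⇒codiagonal pushout f
      -- The inferred arguments are the constant family at the pushout, `inl`, `inr` and `glue`.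
      (acyclic⇒dependent pushout f acyclic _ _ _ _)
  ; 4⇒1 = λ equiv X → HomotopyExtension⇒IsEmbedding ext f (λ _ → X)
      (GlueExtension⇒constant pushout f (codiagonal⇒GlueExtension pushout f equiv) X)
  }
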